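{- Let $V=\{0,\tfrac12,1\}$ and consider any sentential language with an atomic expressive semantics whose consequence relation is induced by the truth-relation $ss\cap tt$. Then no binary connective of the language (with any truth function) is a G-conditional.
   Context: $ss\cap tt=\models_{\{1\},\{1\}}\cap\models_{\{1,\frac12\},\{1,\frac12\}}$, where $\gamma\models_{\mathcal{D}_p,\mathcal{D}_c}\delta$ iff ($\gamma\subseteq\mathcal{D}_p\Rightarrow\delta\cap\mathcal{D}_c\neq\emptyset$). A semantics: set of valuations mapping atoms to $V$, interpreting each connective by a truth function fixed across valuations, extended compositionally, such that every assignment of values to finitely many distinct atoms is realized. Atomic expressive: for every $\gamma\subseteq V$ there are a set of formulas $\Gamma$ and a valuation $v$ with $v(\Gamma)=\gamma$. Consequence: $\Gamma\vdash\Delta$ iff $v(\Gamma)\models v(\Delta)$ for all $v$; $\Gamma,A$ denotes $\Gamma\cup\{A\}$. A G-conditional $\to$ satisfies for all $\Gamma,\Delta,A,B$: $\Gamma\vdash A\to B,\Delta$ iff $\Gamma,A\vdash B,\Delta$; and $\Gamma,A\to B\vdash\Delta$ iff ($\Gamma\vdash A,\Delta$ and $\Gamma,B\vdash\Delta$). -}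

module Defs where

open import Level using (0ℓ)
open import Data.Nat using (ℕ)
open import Data.Fin using (Fin)
open import Data.Vec using (Vec; []; _∷_)
open import Data.Product using (∃-syntax; _×_)
open import Function.Bundles using (_⇔_)
open import Function.Definitions using (Injective)
open import Relation.Nullary using (¬_)
open import Relation.Unary using (Pred; _∈_; _⊆_; _≐_; _∪_; ｛_｝; Empty) renaming (_∩_ to _∩ᵤ_)
open import Relation.Binary.Core using (Rel)
open import Relation.Binary.Construct.Intersection using (_∩_)
open import Relation.Binary.PropositionalEquality using (_≡_)

record Language : Set₁ where
  field
    Atom       : Set
    Connective : ℕ → Set   -- indexed by arity; arity 0 gives constants

data Formula (L : Language) : Set where
  atom : Language.Atom L → Formula L
  app  : ∀ {n} → Language.Connective L n → Vec (Formula L) n → Formula L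

binary : (L : Language) → Language.Connective L 2 → Formula L → Formula L → Formula L
binary L c A B = app c (A ∷ B ∷ [])

record Semantics (L : Language) (V : Set) : Set₁ where
  open Language L
  field
    Valuations    : Pred (Atom → V) 0ℓ
    truthFunction : ∀ {n} → Connective n → Vec V n → V
    realizes      : ∀ {n} (p : Fin n → Atom) → Injective _≡_ _≡_ p → (a : Fin n → V) →
                    ∃[ v ] (v ∈ Valuations × (∀ i → v (p i) ≡ a i))

  mutual
    ⟦_⟧ : Formula L → (Atom → V) → V
    ⟦ atom p ⟧   v = v p
    ⟦ app c As ⟧ v = truthFunction c (⟦ As ⟧* v)

    ⟦_⟧* : ∀ {n} → Vec (Formula L) n → (Atom → V) → Vec V n
    ⟦ [] ⟧*     v = []
    ⟦ A ∷ As ⟧* v = ⟦ A ⟧ v ∷ ⟦ As ⟧* v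

  image : (Atom → V) → Pred (Formula L) 0ℓ → Pred V 0ℓ
  image v Γ x = ∃[ A ] (A ∈ Γ × ⟦ A ⟧ v ≡ x)

  AtomicExpressive : Set₁
  AtomicExpressive = ∀ (γ : Pred V 0ℓ) →
    ∃[ Γ ] ∃[ v ] (v ∈ Valuations × image v Γ ≐ γ)

  Consequence : Rel (Pred V 0ℓ) 0ℓ → Rel (Pred (Formula L) 0ℓ) 0ℓ
  Consequence _⊨_ Γ Δ = ∀ v → v ∈ Valuations → image v Γ ⊨ image v Δ

record IsGConditional {L : Language} (_⊢_ : Rel (Pred (Formula L) 0ℓ) 0ℓ)
                      (_⇒_ : Formula L → Formula L → Formula L) : Set₁ where
  field
    conclusion : ∀ Γ Δ A B →
      (Γ ⊢ (｛ A ⇒ B ｝ ∪ Δ)) ⇔ ((Γ ∪ ｛ A ｝) ⊢ (｛ B ｝ ∪ Δ))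
    premise    : ∀ Γ Δ A B →
      ((Γ ∪ ｛ A ⇒ B ｝) ⊢ Δ) ⇔ ((Γ ⊢ (｛ A ｝ ∪ Δ)) × ((Γ ∪ ｛ B ｝) ⊢ Δ))

-- Nonemptiness is the negation of emptiness, not the existence of a given
-- witness, so that the relation has its classical meaning for arbitrary,
-- possibly undecidable, γ and δ.
mixed : {V : Set} → Pred V 0ℓ → Pred V 0ℓ → Rel (Pred V 0ℓ) 0ℓ
mixed Dp Dc γ δ = γ ⊆ Dp → ¬ Empty (δ ∩ᵤ Dc)

data Three : Set where
  𝟎 ½ 𝟏 : Three

ss tt ss∩tt : Rel (Pred Three 0ℓ) 0ℓ
ss    = mixed ｛ 𝟏 ｝ ｛ 𝟏 ｝
tt    = mixed (｛ 𝟏 ｝ ∪ ｛ ½ ｝) (｛ 𝟏 ｝ ∪ ｛ ½ ｝)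
ss∩tt = ss ∩ tt

{-# OPTIONS --safe #-}

-- Reflexivity and the rule for conditionals in conclusions give ⊢ A → B, A and
-- A → B, A ⊢ B. In a valuation where A takes the value ½ and B the value 0, the
-- first forces A → B to take the value 1 (by ss), and then the second fails (by tt).

module Submission where

open import Data.Empty using (⊥)
open import Data.Product using (_,_; proj₁; proj₂)
open import Data.Sum using (inj₁; inj₂)
open import Function.Bundles using (Equivalence)
open import Level using (0ℓ)
open import Relation.Nullary using (¬_)
open import Relation.Unary using (Pred; _∈_; _∪_; ｛_｝; ∅; U)
open import Relation.Binary.PropositionalEquality using (_≡_; refl; sym; trans)
open import Defs

-- Premises and conclusions share the standard `D`, so once `γ` lies inside `D` the common value `x`
-- is itself a designated conclusion.
mixed-overlap : {V : Set} (D γ δ : Pred V 0ℓ) {x : V} →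
  x ∈ γ → x ∈ δ → mixed D D γ δ
mixed-overlap D γ δ x∈γ x∈δ γ⊆D empty = empty _ (x∈δ , γ⊆D x∈γ)

module _ {L : Language} (S : Semantics L Three) where
  open Semantics S

  private
    _⊢_ : Pred (Formula L) 0ℓ → Pred (Formula L) 0ℓ → Set
    _⊢_ = Consequence ss∩tt

  ⊢-overlap : ∀ Γ Δ {C} → C ∈ Γ → C ∈ Δ → Γ ⊢ Δ
  ⊢-overlap Γ Δ {C} C∈Γ C∈Δ v _ =
      mixed-overlap _ (image v Γ) (image v Δ) C∈γ C∈δ
    , mixed-overlap _ (image v Γ) (image v Δ) C∈γ C∈δ
    where
    C∈γ : ⟦ C ⟧ v ∈ image v Γ
    C∈γ = C , C∈Γ , refl
    C∈δ : ⟦ C ⟧ v ∈ image v Δ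
    C∈δ = C , C∈Δ , refl

  G-conditional-no-½-0 : ∀ {_⇒_} → IsGConditional _⊢_ _⇒_ →
    ∀ {v} → v ∈ Valuations → ∀ A B → ⟦ A ⟧ v ≡ ½ → ⟦ B ⟧ v ≡ 𝟎 → ⊥
  G-conditional-no-½-0 {_⇒_} G {v} v∈ A B A≡½ B≡𝟎 =
    -- The `ss` half: the premise set is empty, so some conclusion must take the value `𝟏`. Neither
    -- does.
    proj₁ (⊢A⇒B,A v v∈) (λ ()) λ where
      _ ((_ , inj₁ refl , A⇒B≡x) , 𝟏≡x) → A⇒B≢𝟏 (trans A⇒B≡x (sym 𝟏≡x))
      _ ((_ , inj₂ refl , A≡x) , refl) → absurd (trans (sym A≡½) A≡x)
    where
    open IsGConditional G

    absurd : ¬ ½ ≡ 𝟏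
    absurd ()

    ⊢A⇒B,A : ∅ ⊢ (｛ A ⇒ B ｝ ∪ ｛ A ｝)
    -- Keeping `A` as a side conclusion turns the rule's right-hand side into an overlap on `A`.
    ⊢A⇒B,A = Equivalence.from (conclusion ∅ ｛ A ｝ A B)
      (⊢-overlap (∅ ∪ ｛ A ｝) (｛ B ｝ ∪ ｛ A ｝) (inj₂ refl) (inj₂ refl))

    A⇒B,A⊢B : (｛ A ⇒ B ｝ ∪ ｛ A ｝) ⊢ (｛ B ｝ ∪ ∅)
    A⇒B,A⊢B = Equivalence.to (conclusion ｛ A ⇒ B ｝ ∅ A B)
      (⊢-overlap ｛ A ⇒ B ｝ (｛ A ⇒ B ｝ ∪ ∅) refl (inj₁ refl))

    A⇒B≢𝟏 : ¬ ⟦ A ⇒ B ⟧ v ≡ 𝟏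
    -- The `tt` half: both premises, of values `𝟏` and `½`, are designated, while the only
    -- conclusion has value `𝟎`.
    A⇒B≢𝟏 A⇒B≡𝟏 = proj₂ (A⇒B,A⊢B v v∈)
      (λ where
        (_ , inj₁ refl , A⇒B≡x) → inj₁ (trans (sym A⇒B≡𝟏) A⇒B≡x)
        (_ , inj₂ refl , A≡x) → inj₂ (trans (sym A≡½) A≡x))
      λ where
        _ ((_ , inj₁ refl , B≡x) , x∈D) → 𝟎∉ (trans (sym B≡𝟎) B≡x) x∈D
      where
      𝟎∉ : ∀ {x} → 𝟎 ≡ x → ¬ x ∈ (｛ 𝟏 ｝ ∪ ｛ ½ ｝)
      𝟎∉ refl (inj₁ ())
      𝟎∉ refl (inj₂ ())

theorem4p4 : (L : Language) (S : Semantics L Three) →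
    Semantics.AtomicExpressive S →
    (c : Language.Connective L 2) →
    ¬ IsGConditional (Semantics.Consequence S ss∩tt) (binary L c)
-- Expressing all of `U` makes one valuation take every value, so `A` of value `½` and `B` of value
-- `𝟎`, possibly compound, coexist under the same `v`.
theorem4p4 L S expressive c G with expressive U
... | Γ , v , v∈ , _ , U⊆image with U⊆image {½} _ | U⊆image {𝟎} _
... | A , _ , A≡½ | B , _ , B≡𝟎 = G-conditional-no-½-0 S G v∈ A B A≡½ B≡𝟎
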